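{- Let $i,k\ge 3$ be integers and put $r=\lfloor (L_i-1)/F_k\rfloor$. Then $$g_0(L_i,L_{i+2},L_{i+k})=\begin{cases}(L_i-1)L_{i+2}-L_i(rF_{k-2}+1) & \text{if } r=0, \text{ or } r\ge 1 \text{ and } (L_i-rF_k)L_{i+2}>F_{k-2}L_i,\\ (rF_k-1)L_{i+2}-L_i\bigl((r-1)F_{k-2}+1\bigr) & \text{otherwise.}\end{cases}$$
   Context: Fibonacci numbers: $F_0=0$, $F_1=1$, $F_n=F_{n-1}+F_{n-2}$. Lucas numbers: $L_0=2$, $L_1=1$, $L_n=L_{n-1}+L_{n-2}$. For positive integers $a_1,\dots,a_l$ with $\gcd(a_1,\dots,a_l)=1$ and an integer $n$, let $d(n;a_1,\dots,a_l)$ be the number of tuples $(x_1,\dots,x_l)$ of nonnegative integers with $a_1x_1+\dots+a_lx_l=n$. For a nonnegative integer $p$, the $p$-Frobenius number $g_p(a_1,\dots,a_l)$ is the largest integer $n$ with $d(n;a_1,\dots,a_l)\le p$ (so $g_0$ is the classical Frobenius number). -}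

module Defs where

open import Data.Nat as ℕ using (ℕ; zero; suc; s≤s; z≤n; NonZero)
import Data.Nat.Properties as ℕ
open import Data.Integer as ℤ using (ℤ; +_)
open import Data.Fin using (Fin)
open import Data.Vec using (Vec; sum; zipWith)
open import Data.Product using (Σ-syntax; ∃-syntax; _×_)
open import Function.Bundles using (_↔_)
open import Relation.Binary.PropositionalEquality using (_≡_)

F : ℕ → ℕ
F zero          = 0
F (suc zero)    = 1
F (suc (suc n)) = F (suc n) ℕ.+ F n

L : ℕ → ℕ
L zero          = 2
L (suc zero)    = 1
L (suc (suc n)) = L (suc n) ℕ.+ L n

F-pos : ∀ n → 0 ℕ.< F (suc n)
F-pos zero    = s≤s z≤n
F-pos (suc n) = ℕ.≤-trans (F-pos n) (ℕ.m≤m+n (F (suc n)) (F n))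

F-nonZero : ∀ {k} → 3 ℕ.≤ k → NonZero (F k)
F-nonZero {suc k} _ = ℕ.>-nonZero (F-pos k)

Representation : ∀ {l} → ℤ → Vec ℕ l → Set
Representation {l} n as = Σ[ xs ∈ Vec ℕ l ] + sum (zipWith ℕ._*_ as xs) ≡ n

-- d[ n ∣ as ]≡ m says that n has exactly m representations.  It is a relation
-- because the number is finite only when the entries of as are positive.
-- ℤ has decidable equality, so each tuple underlies at most one Representation.
d[_∣_]≡_ : ∀ {l} → ℤ → Vec ℕ l → ℕ → Set
d[ n ∣ as ]≡ m = Representation n as ↔ Fin m

d[_∣_]≤_ : ∀ {l} → ℤ → Vec ℕ l → ℕ → Set
d[ n ∣ as ]≤ p = ∃[ m ] (d[ n ∣ as ]≡ m) × m ℕ.≤ p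

-- Meant for positive entries with gcd 1, where such a g always exists.
record IsFrobeniusNumber {l} (p : ℕ) (as : Vec ℕ l) (g : ℤ) : Set where
  field
    d≤p     : d[ g ∣ as ]≤ p
    largest : ∀ n → d[ n ∣ as ]≤ p → n ℤ.≤ g

{-# OPTIONS --safe #-}
-- Write a = Lᵢ, b = Lᵢ₊₂, c = Lᵢ₊ₖ, F = Fₖ, f = Fₖ₋₂.  Then c + f a = F b, so
-- x b + y c = t b − y f a with t = x + y F, and modulo a this is t b.  As 2 f ≤ F
-- and a ≤ b, the least combination of b and c in the residue class of t b, for
-- 0 ≤ t < a, is the greedy one with y = ⌊t/F⌋.  The Frobenius number is a less
-- than the largest of these a values.  They increase within a block of constant
-- y, and the block ends increase with y as long as the blocks are full, so only
-- t = a − 1 and t = r F − 1 compete.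
module Submission where

open import Defs
open import Data.Nat as ℕ using (ℕ; zero; suc; s≤s; z≤n; NonZero)
open import Data.Integer using (ℤ; +_; -[1+_]; _+_; _-_; _*_; _>_)
open import Data.Vec using (Vec; []; _∷_)
open import Data.Product using (_×_; _,_; ∃-syntax)
open import Data.Sum using (_⊎_; inj₁; inj₂)
open import Relation.Nullary using (¬_)
open import Relation.Binary.PropositionalEquality using (_≡_; refl; sym; trans; cong; cong₂; subst; subst₂; module ≡-Reasoning)
open import Data.Empty using (⊥-elim)
open import Data.Integer using (-_)
import Data.Integer as ℤ
import Data.Integer.Coprimality as ℤ
import Data.Integer.DivMod as ℤ
import Data.Integer.Divisibility.Signed as Signed
import Data.Integer.Properties as ℤ
import Data.Integer.Tactic.RingSolver as ℤ-Ring
open import Data.Nat.Coprimality using (Coprime; coprime-+; coprime-Bézout)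
import Data.Nat.Coprimality as Coprimality
import Data.Nat.DivMod as ℕ
open import Data.Nat.GCD using (module Bézout)
import Data.Nat.Properties as ℕ
import Data.Nat.Tactic.RingSolver as ℕ-Ring
open import Function.Bundles using (Inverse; mk↔ₛ′)

-- The case `p = 0`: at most zero representations.

¬Representation⇒d≤0 : ∀ {l n} {as : Vec ℕ l} → ¬ Representation n as → d[ n ∣ as ]≤ 0
¬Representation⇒d≤0 ¬rep =
  0 , mk↔ₛ′ (λ rep → ⊥-elim (¬rep rep)) (λ ()) (λ ()) (λ rep → ⊥-elim (¬rep rep)) , z≤n

d≤0⇒¬Representation : ∀ {l n} {as : Vec ℕ l} → d[ n ∣ as ]≤ 0 → ¬ Representation n as
d≤0⇒¬Representation (.0 , iso , z≤n) rep with Inverse.to iso rep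
... | ()

-- Residue classes modulo `a`.

coprime⇒Bézoutℤ : ∀ {a b} → Coprime a b → ∃[ v ] ∃[ w ] + 1 ≡ v * + a + w * + b
coprime⇒Bézoutℤ {a} {b} coprime with coprime-Bézout coprime
... | Bézout.+- x y eq = + x , - + y , (begin
  + 1                           ≡⟨ cancel (+ 1) (+ y * + b) ⟩
  + 1 + + y * + b - + y * + b   ≡⟨ cong (_- + y * + b) eqℤ ⟩
  + x * + a - + y * + b         ≡⟨ cong (λ e → + x * + a + e) (ℤ.neg-distribˡ-* (+ y) (+ b)) ⟩
  + x * + a + - + y * + b       ∎)
  where
  open ≡-Reasoning
  cancel : ∀ i j → i ≡ i + j - j
  cancel = ℤ-Ring.solve-∀
  eqℤ : + 1 + + y * + b ≡ + x * + a
  eqℤ = trans (cong (λ e → + 1 + e) (sym (ℤ.pos-* y b))) (trans (cong +_ eq) (ℤ.pos-* x a))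
... | Bézout.-+ x y eq = - + x , + y , (begin
  + 1                           ≡⟨ cancel (+ 1) (+ x * + a) ⟩
  - (+ x * + a) + (+ 1 + + x * + a)   ≡⟨ cong₂ _+_ (ℤ.neg-distribˡ-* (+ x) (+ a)) eqℤ ⟩
  - + x * + a + + y * + b       ∎)
  where
  open ≡-Reasoning
  cancel : ∀ i j → i ≡ - j + (i + j)
  cancel = ℤ-Ring.solve-∀
  eqℤ : + 1 + + x * + a ≡ + y * + b
  eqℤ = trans (cong (λ e → + 1 + e) (sym (ℤ.pos-* x a))) (trans (cong +_ eq) (ℤ.pos-* y b))

-- Bézout makes `w` an inverse of `b` modulo `a`, so the remainder of `n * w` serves as `t`.
residue : ∀ {a b} .{{_ : NonZero a}} → Coprime a b → ∀ n → ∃[ t ] ∃[ q ] t ℕ.< a × n ≡ + t * + b + q * + a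
residue {a} {b} coprime n with coprime⇒Bézoutℤ coprime
... | v , w , vw = m ℤ.%ℕ a , m ℤ./ℕ a * + b + n * v , ℤ.n%ℕd<d m a , (begin
  n                            ≡⟨ ℤ.*-identityʳ n ⟨
  n * + 1                      ≡⟨ cong (n *_) vw ⟩
  n * (v * + a + w * + b)      ≡⟨ distrib n v (+ a) w (+ b) ⟩
  m * + b + n * v * + a        ≡⟨ cong (λ m → m * + b + n * v * + a) (ℤ.a≡a%ℕn+[a/ℕn]*n m a) ⟩
  (+ (m ℤ.%ℕ a) + m ℤ./ℕ a * + a) * + b + n * v * + a
                               ≡⟨ collect (+ (m ℤ.%ℕ a)) (m ℤ./ℕ a) (+ a) (+ b) (n * v) ⟩
  + (m ℤ.%ℕ a) * + b + (m ℤ./ℕ a * + b + n * v) * + a ∎)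
  where
  open ≡-Reasoning
  m = n * w
  distrib : ∀ n v a w b → n * (v * a + w * b) ≡ n * w * b + n * v * a
  distrib = ℤ-Ring.solve-∀
  collect : ∀ t q a b u → (t + q * a) * b + u * a ≡ t * b + (q * b + u) * a
  collect = ℤ-Ring.solve-∀

-- The sign of `q` decides the case. For `t < a` the last outcome is absurd, so a number congruent
-- to `t` is `t` itself or exceeds it by at least `a`.
congruent-cases : ∀ {a t u} q → + u ≡ + t + q * + a →
                  u ≡ t ⊎ (∃[ w ] a ℕ.≤ w × u ≡ t ℕ.+ w) ⊎ a ℕ.≤ t
congruent-cases {t = t} (+ zero) eq = inj₁ (ℤ.+-injective (trans eq (ℤ.+-identityʳ (+ t))))
congruent-cases {a} {t} (+ suc m) eq = inj₂ (inj₁ (suc m ℕ.* a , ℕ.m≤m+n a (m ℕ.* a) ,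
  ℤ.+-injective (trans eq (cong (λ e → + t + e) (sym (ℤ.pos-* (suc m) a))))))
congruent-cases {a} {t} {u} -[1+ m ] eq = inj₂ (inj₂ (begin
  a                       ≤⟨ ℕ.m≤m+n a (m ℕ.* a) ⟩
  suc m ℕ.* a             ≤⟨ ℕ.m≤n+m _ u ⟩
  u ℕ.+ suc m ℕ.* a       ≡⟨ ℤ.+-injective moved ⟩
  t                       ∎))
  where
  open ℕ.≤-Reasoning
  cancel : ∀ t k a → t + - k * a + k * a ≡ t
  cancel = ℤ-Ring.solve-∀
  moved : + u + + (suc m ℕ.* a) ≡ + t
  moved = trans (cong₂ _+_ eq (ℤ.pos-* (suc m) a)) (cancel (+ t) (+ suc m) (+ a))

-- Meant for a representation of `m - a` with `z` copies of `a` and remaining part `v`: that part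
-- lands in the class of `m` but at least `a` lower, against the minimality of `m`.
shift-down : ∀ {m v z a} .{{_ : NonZero a}} → + (v ℕ.+ z ℕ.* a) ≡ + m - + a →
             + v ≡ + m + - + suc z * + a × v ℕ.< m
shift-down {m} {v} {z} {a} eq = congruent , ℕ.≤-<-trans (ℕ.m≤m+n v (z ℕ.* a))
    (subst (v ℕ.+ z ℕ.* a ℕ.<_) (ℤ.+-injective total) (ℕ.m<m+n _ (ℕ.>-nonZero⁻¹ a)))
  where
  open ≡-Reasoning
  isolate : ∀ v z a → v ≡ v + z * a + a + - (+ 1 + z) * a
  isolate = ℤ-Ring.solve-∀
  cancel : ∀ v a → v - a + a ≡ v
  cancel = ℤ-Ring.solve-∀
  total : + (v ℕ.+ z ℕ.* a) + + a ≡ + m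
  total = trans (cong (_+ + a) eq) (cancel (+ m) (+ a))
  congruent : + v ≡ + m + - + suc z * + a
  congruent = begin
    + v                                        ≡⟨ isolate (+ v) (+ z) (+ a) ⟩
    + v + + z * + a + + a + - + suc z * + a    ≡⟨ cong (λ e → + v + e + + a + - + suc z * + a) (ℤ.pos-* z a) ⟨
    + v + + (z ℕ.* a) + + a + - + suc z * + a  ≡⟨ cong (_+ - + suc z * + a) total ⟩
    + m + - + suc z * + a                      ∎

shift-up : ∀ {m v n a} → v ℕ.≤ m → + m - + a ℤ.< n → ∀ z → n ≡ + v + z * + a →
           ∃[ z′ ] n ≡ + (v ℕ.+ z′ ℕ.* a)
shift-up {v = v} {a = a} v≤m g<n (+ z) n≡ = z , trans n≡ (cong (λ e → + v + e) (sym (ℤ.pos-* z a)))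
-- A negative coefficient would put `n` at or below `v - a`, hence at or below `m - a`.
shift-up {m} {v} {n} {a} v≤m g<n -[1+ z ] n≡ = ⊥-elim (ℤ.<⇒≱ g<n (begin
  n                         ≡⟨ n≡ ⟩
  + v + -[1+ z ] * + a      ≤⟨ ℤ.+-mono-≤ (ℤ.+≤+ v≤m) (ℤ.*-monoʳ-≤-nonNeg (+ a) { -[1+ z ]} { -[1+ 0 ]} (ℤ.-≤- z≤n)) ⟩
  + m + - + 1 * + a         ≡⟨ cong (λ e → + m + e) (ℤ.-1*i≡-i (+ a)) ⟩
  + m - + a                 ∎))
  where open ℤ.≤-Reasoning

-- The Apéry set of `a` in the semigroup generated by `a`, `b` and `c`.

module Apéry
  {a b c F f : ℕ} .{{_ : NonZero a}} .{{_ : NonZero F}}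
  (coprime : Coprime a b) (a≤b : a ℕ.≤ b) (2f≤F : 2 ℕ.* f ℕ.≤ F)
  (c+fa≡Fb : c ℕ.+ f ℕ.* a ≡ F ℕ.* b)
  where

  value : ℕ → ℕ → ℕ
  value x y = x ℕ.* b ℕ.+ y ℕ.* c

  weight : ℕ → ℕ → ℕ
  weight x y = x ℕ.+ y ℕ.* F

  value-weight : ∀ x y → value x y ℕ.+ y ℕ.* f ℕ.* a ≡ weight x y ℕ.* b
  value-weight x y = begin
    x ℕ.* b ℕ.+ y ℕ.* c ℕ.+ y ℕ.* f ℕ.* a  ≡⟨ factor x b y c f a ⟩
    x ℕ.* b ℕ.+ y ℕ.* (c ℕ.+ f ℕ.* a)      ≡⟨ cong (λ e → x ℕ.* b ℕ.+ y ℕ.* e) c+fa≡Fb ⟩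
    x ℕ.* b ℕ.+ y ℕ.* (F ℕ.* b)            ≡⟨ distrib x b y F ⟩
    weight x y ℕ.* b                       ∎
    where
    open ≡-Reasoning
    factor : ∀ x b y c f a → x ℕ.* b ℕ.+ y ℕ.* c ℕ.+ y ℕ.* f ℕ.* a ≡ x ℕ.* b ℕ.+ y ℕ.* (c ℕ.+ f ℕ.* a)
    factor = ℕ-Ring.solve-∀
    distrib : ∀ x b y F → x ℕ.* b ℕ.+ y ℕ.* (F ℕ.* b) ≡ (x ℕ.+ y ℕ.* F) ℕ.* b
    distrib = ℕ-Ring.solve-∀

  value-weightℤ : ∀ x y → + value x y + + (y ℕ.* f) * + a ≡ + weight x y * + b
  value-weightℤ x y = begin
    + value x y + + (y ℕ.* f) * + a  ≡⟨ cong (λ e → + value x y + e) (ℤ.pos-* (y ℕ.* f) a) ⟨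
    + (value x y ℕ.+ y ℕ.* f ℕ.* a)  ≡⟨ cong +_ (value-weight x y) ⟩
    + (weight x y ℕ.* b)             ≡⟨ ℤ.pos-* (weight x y) b ⟩
    + weight x y * + b               ∎
    where open ≡-Reasoning

  -- The greedy pairs: `x` and `y` are the remainder and the quotient by `F` of a residue index
  -- below `a`. Each class modulo `a` has exactly one such pair.
  Reduced : ℕ → ℕ → Set
  Reduced x y = x ℕ.< F × weight x y ℕ.< a

  value-residue : ∀ x y q → + weight x y * + b + q * + a ≡ + value x y + (+ (y ℕ.* f) + q) * + a
  value-residue x y q = begin
    + weight x y * + b + q * + a               ≡⟨ cong (_+ q * + a) (value-weightℤ x y) ⟨
    + value x y + + (y ℕ.* f) * + a + q * + a  ≡⟨ collect (+ value x y) (+ (y ℕ.* f)) (+ a) q ⟩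
    + value x y + (+ (y ℕ.* f) + q) * + a      ∎
    where
    open ≡-Reasoning
    collect : ∀ v k a q → v + k * a + q * a ≡ v + (k + q) * a
    collect = ℤ-Ring.solve-∀

  reduce : ∀ n → ∃[ x ] ∃[ y ] ∃[ z ] Reduced x y × n ≡ + value x y + z * + a
  reduce n =
    let t , q , t<a , n≡ = residue coprime n
        t≡ = ℕ.m≡m%n+[m/n]*n t F
        x = t ℕ.% F
        y = t ℕ./ F
    in x , y , + (y ℕ.* f) + q , (ℕ.m%n<n t F , subst (ℕ._< a) t≡ t<a) ,
       trans n≡ (trans (cong (λ u → + u * + b + q * + a) t≡) (value-residue x y q))

  -- A value is its weight times `b`, less `y f a`, so equal weights compare by `y` alone; `x < F`
  -- makes `y` the largest quotient possible.
  value-≤-same-weight : ∀ {x y x′ y′} → x ℕ.< F → weight x′ y′ ≡ weight x y → value x y ℕ.≤ value x′ y′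
  value-≤-same-weight {x} {y} {x′} {y′} x<F w≡ = ℕ.+-cancelʳ-≤ (y ℕ.* f ℕ.* a) _ _ (begin
    value x y ℕ.+ y ℕ.* f ℕ.* a      ≡⟨ value-weight x y ⟩
    weight x y ℕ.* b                 ≡⟨ cong (ℕ._* b) w≡ ⟨
    weight x′ y′ ℕ.* b               ≡⟨ value-weight x′ y′ ⟨
    value x′ y′ ℕ.+ y′ ℕ.* f ℕ.* a   ≤⟨ ℕ.+-monoʳ-≤ (value x′ y′) (ℕ.*-monoˡ-≤ a (ℕ.*-monoˡ-≤ f y′≤y)) ⟩
    value x′ y′ ℕ.+ y ℕ.* f ℕ.* a    ∎)
    where
    open ℕ.≤-Reasoning
    y′≤y : y′ ℕ.≤ y
    y′≤y = ℕ.≤-pred (ℕ.*-cancelʳ-< F y′ (suc y) (begin-strict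
      y′ ℕ.* F          ≤⟨ ℕ.m≤n+m _ x′ ⟩
      weight x′ y′      ≡⟨ w≡ ⟩
      x ℕ.+ y ℕ.* F     <⟨ ℕ.+-monoˡ-< (y ℕ.* F) x<F ⟩
      suc y ℕ.* F       ∎))

  -- Each y′ uses up weight F and saves f a, so by 2 f ≤ F the total saving is at
  -- most half of a times the weight, which the extra w b outweighs.
  value-≤-larger-weight : ∀ {x y x′ y′ w} → weight x y ℕ.< a → a ℕ.≤ w →
                          weight x′ y′ ≡ weight x y ℕ.+ w → value x y ℕ.≤ value x′ y′
  value-≤-larger-weight {x} {y} {x′} {y′} {w} t<a a≤w u≡ =
    ℕ.*-cancelˡ-≤ 2 (ℕ.+-cancelʳ-≤ (2 ℕ.* (y′ ℕ.* f ℕ.* a)) _ _ (begin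
      2 ℕ.* value x y ℕ.+ 2 ℕ.* (y′ ℕ.* f ℕ.* a)
        ≤⟨ ℕ.+-mono-≤ (ℕ.*-monoʳ-≤ 2 value≤) discount≤ ⟩
      2 ℕ.* (t ℕ.* b) ℕ.+ 2 ℕ.* (w ℕ.* b)
        ≡⟨ collect t b w ⟩
      2 ℕ.* ((t ℕ.+ w) ℕ.* b)
        ≡⟨ cong (λ u → 2 ℕ.* (u ℕ.* b)) u≡ ⟨
      2 ℕ.* (weight x′ y′ ℕ.* b)
        ≡⟨ cong (2 ℕ.*_) (value-weight x′ y′) ⟨
      2 ℕ.* (value x′ y′ ℕ.+ y′ ℕ.* f ℕ.* a)
        ≡⟨ ℕ.*-distribˡ-+ 2 (value x′ y′) _ ⟩
      2 ℕ.* value x′ y′ ℕ.+ 2 ℕ.* (y′ ℕ.* f ℕ.* a) ∎))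
    where
    open ℕ.≤-Reasoning
    t = weight x y
    collect : ∀ t b w → 2 ℕ.* (t ℕ.* b) ℕ.+ 2 ℕ.* (w ℕ.* b) ≡ 2 ℕ.* ((t ℕ.+ w) ℕ.* b)
    collect = ℕ-Ring.solve-∀
    swap : ∀ y f a → 2 ℕ.* (y ℕ.* f ℕ.* a) ≡ y ℕ.* (2 ℕ.* f) ℕ.* a
    swap = ℕ-Ring.solve-∀
    double : ∀ e → e ℕ.+ e ≡ 2 ℕ.* e
    double = ℕ-Ring.solve-∀
    value≤ : value x y ℕ.≤ t ℕ.* b
    value≤ = subst (value x y ℕ.≤_) (value-weight x y) (ℕ.m≤m+n _ _)
    discount≤ : 2 ℕ.* (y′ ℕ.* f ℕ.* a) ℕ.≤ 2 ℕ.* (w ℕ.* b)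
    discount≤ = begin
      2 ℕ.* (y′ ℕ.* f ℕ.* a)     ≡⟨ swap y′ f a ⟩
      y′ ℕ.* (2 ℕ.* f) ℕ.* a     ≤⟨ ℕ.*-monoˡ-≤ a (ℕ.*-monoʳ-≤ y′ 2f≤F) ⟩
      y′ ℕ.* F ℕ.* a             ≤⟨ ℕ.*-monoˡ-≤ a (ℕ.m≤n+m _ x′) ⟩
      weight x′ y′ ℕ.* a         ≡⟨ cong (ℕ._* a) u≡ ⟩
      (t ℕ.+ w) ℕ.* a            ≤⟨ ℕ.*-monoˡ-≤ a (ℕ.+-monoˡ-≤ w (ℕ.≤-trans (ℕ.<⇒≤ t<a) a≤w)) ⟩
      (w ℕ.+ w) ℕ.* a            ≤⟨ ℕ.*-monoʳ-≤ (w ℕ.+ w) a≤b ⟩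
      (w ℕ.+ w) ℕ.* b            ≡⟨ cong (ℕ._* b) (double w) ⟩
      2 ℕ.* w ℕ.* b              ≡⟨ ℕ.*-assoc 2 w b ⟩
      2 ℕ.* (w ℕ.* b)            ∎

  -- Modulo `a` a value is its weight times `b`, and `b` cancels because it is coprime to `a`.
  weight-congruent : ∀ {x y x′ y′ k} → + value x′ y′ ≡ + value x y + k * + a →
                     ∃[ q ] + weight x′ y′ ≡ + weight x y + q * + a
  weight-congruent {x} {y} {x′} {y′} {k} eq =
    quotient , trans (recombine (+ weight x′ y′) (+ weight x y)) (cong (λ e → + weight x y + e) equality)
    where
    open ≡-Reasoning
    difference = + weight x′ y′ - + weight x y
    distrib : ∀ b u t → b * (u - t) ≡ u * b - t * b
    distrib = ℤ-Ring.solve-∀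
    collect : ∀ v k a g h → v + k * a + g * a - (v + h * a) ≡ (k + g - h) * a
    collect = ℤ-Ring.solve-∀
    recombine : ∀ u t → u ≡ t + (u - t)
    recombine = ℤ-Ring.solve-∀
    a∣b*difference : + a Signed.∣ + b * difference
    a∣b*difference = Signed.divides (k + + (y′ ℕ.* f) - + (y ℕ.* f)) (begin
      + b * difference
        ≡⟨ distrib (+ b) (+ weight x′ y′) (+ weight x y) ⟩
      + weight x′ y′ * + b - + weight x y * + b
        ≡⟨ cong₂ _-_ (value-weightℤ x′ y′) (value-weightℤ x y) ⟨
      + value x′ y′ + + (y′ ℕ.* f) * + a - (+ value x y + + (y ℕ.* f) * + a)
        ≡⟨ cong (λ v → v + + (y′ ℕ.* f) * + a - (+ value x y + + (y ℕ.* f) * + a)) eq ⟩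
      + value x y + k * + a + + (y′ ℕ.* f) * + a - (+ value x y + + (y ℕ.* f) * + a)
        ≡⟨ collect (+ value x y) k (+ a) (+ (y′ ℕ.* f)) (+ (y ℕ.* f)) ⟩
      (k + + (y′ ℕ.* f) - + (y ℕ.* f)) * + a ∎)
    a∣difference : + a Signed.∣ difference
    a∣difference = Signed.∣ᵤ⇒∣ {+ a} {difference}
      (ℤ.coprime-divisor (+ a) (+ b) difference coprime (Signed.∣⇒∣ᵤ a∣b*difference))
    -- The fields `quotient` and `equality` supply the `q` and the equation of the conclusion.
    open Signed._∣_ a∣difference

  -- This identifies the reduced values as the Apéry set. A rival in the same class has a congruent
  -- weight, which is either the same or larger by at least `a`; each case has its own comparison.
  minimal : ∀ {x y x′ y′ k} → Reduced x y → + value x′ y′ ≡ + value x y + k * + a → value x y ℕ.≤ value x′ y′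
  minimal {x} {y} {x′} {y′} {k} (x<F , t<a) eq =
    let q , w≡ = weight-congruent {x} {y} {x′} {y′} {k} eq
    in byCases (congruent-cases q w≡)
    where
    byCases : weight x′ y′ ≡ weight x y ⊎ (∃[ w ] a ℕ.≤ w × weight x′ y′ ≡ weight x y ℕ.+ w) ⊎ a ℕ.≤ weight x y →
              value x y ℕ.≤ value x′ y′
    byCases (inj₁ u≡t)                   = value-≤-same-weight {x} {y} {x′} {y′} x<F u≡t
    byCases (inj₂ (inj₁ (w , a≤w , u≡))) = value-≤-larger-weight {x} {y} {x′} {y′} t<a a≤w u≡
    byCases (inj₂ (inj₂ a≤t))            = ⊥-elim (ℕ.<⇒≱ t<a a≤t)

  combination : ∀ z x y → a ℕ.* z ℕ.+ (b ℕ.* x ℕ.+ (c ℕ.* y ℕ.+ 0)) ≡ value x y ℕ.+ z ℕ.* a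
  combination z x y = lemma a b c z x y
    where
    lemma : ∀ a b c z x y → a ℕ.* z ℕ.+ (b ℕ.* x ℕ.+ (c ℕ.* y ℕ.+ 0)) ≡ x ℕ.* b ℕ.+ y ℕ.* c ℕ.+ z ℕ.* a
    lemma = ℕ-Ring.solve-∀

  -- Removing the copies of `a` from a representation would leave a combination of `b` and `c` in
  -- the class of `value x y` but below it.
  not-representable : ∀ {x y} → Reduced x y → ¬ Representation (+ value x y - + a) (a ∷ b ∷ c ∷ [])
  not-representable {x} {y} reduced (z ∷ x′ ∷ y′ ∷ [] , eq) =
    let congruent , below = shift-down {value x y} {value x′ y′} {z} {a} (trans (cong +_ (sym (combination z x′ y′))) eq)
    in ℕ.<⇒≱ below (minimal {x} {y} {x′} {y′} { - + suc z} reduced congruent)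

  -- The reduced value in the class of `n` is at most `m`, hence below `n + a`. Being congruent to
  -- `n`, it is at most `n`, and copies of `a` fill the gap.
  representable : ∀ {m} → (∀ {x y} → Reduced x y → value x y ℕ.≤ m) →
                  ∀ n → + m - + a ℤ.< n → Representation n (a ∷ b ∷ c ∷ [])
  representable {m} maximal n g<n =
    let x , y , z , reduced , n≡ = reduce n
        z′ , n≡′ = shift-up {m} {value x y} (maximal {x} {y} reduced) g<n z n≡
    in z′ ∷ x ∷ y ∷ [] , trans (cong +_ (combination z′ x y)) (sym n≡′)

  -- The criterion of Brauer and Shockley, with the Apéry set enumerated by reduced pairs.
  frobenius : ∀ {x y} → Reduced x y → (∀ {x′ y′} → Reduced x′ y′ → value x′ y′ ℕ.≤ value x y) →
              IsFrobeniusNumber 0 (a ∷ b ∷ c ∷ []) (+ value x y - + a)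
  frobenius {x} {y} reduced maximal = record
    { d≤p     = ¬Representation⇒d≤0 {as = a ∷ b ∷ c ∷ []} (not-representable {x} {y} reduced)
    ; largest = λ n d≤0 → ℤ.≮⇒≥ λ g<n →
        d≤0⇒¬Representation {as = a ∷ b ∷ c ∷ []} d≤0 (representable (λ {x′} {y′} → maximal {x′} {y′}) n g<n)
    }

  -- The largest element of the Apéry set and its closed form.

  module _ {s r} (s<F : s ℕ.< F) (a≡ : suc (weight s r) ≡ a) where

    -- As `a - 1 = s + r F` with `s < F`, the last block is `y = r`, and it stops at `x = s`.
    reduced-cases : ∀ {x y} → Reduced x y → (x ℕ.≤ s × y ≡ r) ⊎ y ℕ.< r
    reduced-cases {x} {y} (x<F , w<a) with ℕ.m≤n⇒m<n∨m≡n y≤r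
      where
      open ℕ.≤-Reasoning
      y≤r : y ℕ.≤ r
      y≤r = ℕ.≤-pred (ℕ.*-cancelʳ-< F y (suc r) (begin-strict
        y ℕ.* F          ≤⟨ ℕ.m≤n+m _ x ⟩
        weight x y       ≤⟨ ℕ.≤-pred (subst (weight x y ℕ.<_) (sym a≡) w<a) ⟩
        s ℕ.+ r ℕ.* F    <⟨ ℕ.+-monoˡ-< (r ℕ.* F) s<F ⟩
        suc r ℕ.* F      ∎))
    ... | inj₁ y<r  = inj₂ y<r
    ... | inj₂ refl = inj₁ (ℕ.+-cancelʳ-≤ (r ℕ.* F) x s (ℕ.≤-pred (subst (weight x y ℕ.<_) (sym a≡) w<a)) , refl)

    -- The strongest rival in the earlier blocks is the end `(F - 1 , r - 1)` of the last of them.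
    -- By `c + f a = F b`, passing from it to `(s , r)` changes the value by `(s + 1) b - f a`.
    last-maximal : r ≡ 0 ⊎ f ℕ.* a ℕ.≤ suc s ℕ.* b → ∀ {x y} → Reduced x y → value x y ℕ.≤ value s r
    last-maximal cond {x} {y} reduced@(x<F , _) = byCases cond (reduced-cases {x} {y} reduced)
      where
      open ℕ.≤-Reasoning
      rearrange : ∀ c f a r → (c ℕ.+ f ℕ.* a) ℕ.+ r ℕ.* c ≡ f ℕ.* a ℕ.+ suc r ℕ.* c
      rearrange = ℕ-Ring.solve-∀
      inner : ∀ r → f ℕ.* a ℕ.≤ suc s ℕ.* b → y ℕ.< r → value x y ℕ.≤ value s r
      -- Adding `b` to both sides turns `F - 1` into `F`, so `c + f a = F b` applies without
      -- subtraction.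
      inner (suc r′) fa≤ (s≤s y≤r′) = ℕ.+-cancelˡ-≤ b _ _ (begin
        b ℕ.+ value x y                   ≡⟨ ℕ.+-assoc b (x ℕ.* b) (y ℕ.* c) ⟨
        suc x ℕ.* b ℕ.+ y ℕ.* c           ≤⟨ ℕ.+-mono-≤ (ℕ.*-monoˡ-≤ b x<F) (ℕ.*-monoˡ-≤ c y≤r′) ⟩
        F ℕ.* b ℕ.+ r′ ℕ.* c              ≡⟨ cong (ℕ._+ r′ ℕ.* c) c+fa≡Fb ⟨
        (c ℕ.+ f ℕ.* a) ℕ.+ r′ ℕ.* c      ≡⟨ rearrange c f a r′ ⟩
        f ℕ.* a ℕ.+ suc r′ ℕ.* c          ≤⟨ ℕ.+-monoˡ-≤ (suc r′ ℕ.* c) fa≤ ⟩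
        suc s ℕ.* b ℕ.+ suc r′ ℕ.* c      ≡⟨ ℕ.+-assoc b (s ℕ.* b) (suc r′ ℕ.* c) ⟩
        b ℕ.+ value s (suc r′)            ∎)
      byCases : r ≡ 0 ⊎ f ℕ.* a ℕ.≤ suc s ℕ.* b → (x ℕ.≤ s × y ≡ r) ⊎ y ℕ.< r → value x y ℕ.≤ value s r
      byCases _           (inj₁ (x≤s , y≡r)) = ℕ.+-mono-≤ (ℕ.*-monoˡ-≤ b x≤s) (ℕ.≤-reflexive (cong (ℕ._* c) y≡r))
      byCases (inj₁ r≡0)  (inj₂ y<r)         = ⊥-elim (ℕ.n≮0 (subst (y ℕ.<_) r≡0 y<r))
      byCases (inj₂ fa≤)  (inj₂ y<r)         = inner r fa≤ y<r

    -- The difference `(s + 1) b - f a` now has the opposite sign, which settles block `r`. Pairs of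
    -- earlier blocks are dominated coordinatewise.
    block-end-maximal : ∀ {r′} → r ≡ suc r′ → suc s ℕ.* b ℕ.≤ f ℕ.* a →
                        ∀ {x y} → Reduced x y → value x y ℕ.≤ value (ℕ.pred F) r′
    block-end-maximal {r′} r≡ ≤fa {x} {y} reduced@(x<F , _) = byCases (reduced-cases {x} {y} reduced)
      where
      open ℕ.≤-Reasoning
      rearrange : ∀ c f a r → f ℕ.* a ℕ.+ suc r ℕ.* c ≡ (c ℕ.+ f ℕ.* a) ℕ.+ r ℕ.* c
      rearrange = ℕ-Ring.solve-∀
      byCases : (x ℕ.≤ s × y ≡ r) ⊎ y ℕ.< r → value x y ℕ.≤ value (ℕ.pred F) r′
      byCases (inj₂ y<r) = ℕ.+-mono-≤ (ℕ.*-monoˡ-≤ b (ℕ.<⇒≤pred x<F))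
                                      (ℕ.*-monoˡ-≤ c (ℕ.≤-pred (subst (y ℕ.<_) r≡ y<r)))
      byCases (inj₁ (x≤s , y≡r)) = ℕ.+-cancelˡ-≤ b _ _ (begin
        b ℕ.+ value x y                    ≡⟨ ℕ.+-assoc b (x ℕ.* b) (y ℕ.* c) ⟨
        suc x ℕ.* b ℕ.+ y ℕ.* c            ≤⟨ ℕ.+-monoˡ-≤ (y ℕ.* c) (ℕ.*-monoˡ-≤ b (s≤s x≤s)) ⟩
        suc s ℕ.* b ℕ.+ y ℕ.* c            ≤⟨ ℕ.+-monoˡ-≤ (y ℕ.* c) ≤fa ⟩
        f ℕ.* a ℕ.+ y ℕ.* c                ≡⟨ cong (λ y → f ℕ.* a ℕ.+ y ℕ.* c) (trans y≡r r≡) ⟩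
        f ℕ.* a ℕ.+ suc r′ ℕ.* c           ≡⟨ rearrange c f a r′ ⟩
        (c ℕ.+ f ℕ.* a) ℕ.+ r′ ℕ.* c       ≡⟨ cong (ℕ._+ r′ ℕ.* c) c+fa≡Fb ⟩
        F ℕ.* b ℕ.+ r′ ℕ.* c               ≡⟨ cong (λ e → e ℕ.* b ℕ.+ r′ ℕ.* c) (ℕ.suc-pred F) ⟨
        suc (ℕ.pred F) ℕ.* b ℕ.+ r′ ℕ.* c  ≡⟨ ℕ.+-assoc b (ℕ.pred F ℕ.* b) (r′ ℕ.* c) ⟩
        b ℕ.+ value (ℕ.pred F) r′          ∎)

    block-end-weight : ∀ {r′} → r ≡ suc r′ → suc (weight (ℕ.pred F) r′) ≡ r ℕ.* F
    block-end-weight {r′} r≡ = begin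
      suc (ℕ.pred F) ℕ.+ r′ ℕ.* F  ≡⟨ cong (ℕ._+ r′ ℕ.* F) (ℕ.suc-pred F) ⟩
      suc r′ ℕ.* F                 ≡⟨ cong (ℕ._* F) r≡ ⟨
      r ℕ.* F                      ∎
      where open ≡-Reasoning

    block-end-reduced : ∀ {r′} → r ≡ suc r′ → Reduced (ℕ.pred F) r′
    block-end-reduced {r′} r≡ = ℕ.≤-reflexive (ℕ.suc-pred F) , (begin
      suc (weight (ℕ.pred F) r′)  ≡⟨ block-end-weight r≡ ⟩
      r ℕ.* F                     ≤⟨ ℕ.m≤n+m _ s ⟩
      s ℕ.+ r ℕ.* F               ≤⟨ ℕ.n≤1+n _ ⟩
      suc (weight s r)            ≡⟨ a≡ ⟩
      a                           ∎)
      where open ℕ.≤-Reasoning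

    -- The weight enters through its successor `u`, which is `a` for `(s , r)` and `r F` for the end
    -- of block `r - 1`; these give the two formulas of the theorem.
    value-formula : ∀ {x y} u → suc (weight x y) ≡ u →
                    + value x y - + a ≡ (+ u - + 1) * + b - + a * (+ y * + f + + 1)
    value-formula {x} {y} .(suc (weight x y)) refl = begin
      + value x y - + a
        ≡⟨ insert (+ value x y) (+ y) (+ f) (+ a) ⟩
      + value x y + + y * + f * + a - + a * (+ y * + f + + 1)
        ≡⟨ cong (λ e → + value x y + e * + a - + a * (+ y * + f + + 1)) (ℤ.pos-* y f) ⟨
      + value x y + + (y ℕ.* f) * + a - + a * (+ y * + f + + 1)
        ≡⟨ cong (_- + a * (+ y * + f + + 1)) (value-weightℤ x y) ⟩
      + weight x y * + b - + a * (+ y * + f + + 1) ∎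
      where
      open ≡-Reasoning
      insert : ∀ v y f a → v - a ≡ v + y * f * a - a * (y * f + + 1)
      insert = ℤ-Ring.solve-∀

    -- The factor `a - r F` is the length `s + 1` of block `r`, so the side condition of the theorem
    -- compares the same two numbers as `last-maximal`.
    remainderℤ : (+ a - + r * + F) * + b ≡ + (suc s ℕ.* b)
    remainderℤ = begin
      (+ a - + r * + F) * + b                ≡⟨ cong (λ e → (+ e - + r * + F) * + b) a≡ ⟨
      (+ suc s + + (r ℕ.* F) - + r * + F) * + b ≡⟨ cong (λ e → (+ suc s + e - + r * + F) * + b) (ℤ.pos-* r F) ⟩
      (+ suc s + + r * + F - + r * + F) * + b   ≡⟨ cong (_* + b) (cancel (+ suc s) (+ r * + F)) ⟩
      + suc s * + b                          ≡⟨ ℤ.pos-* (suc s) b ⟨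
      + (suc s ℕ.* b)                        ∎
      where
      open ≡-Reasoning
      cancel : ∀ i j → i + j - j ≡ i
      cancel = ℤ-Ring.solve-∀

    -- The residue index a − 1, reached by (s , r), has the largest value.
    LastWins : Set
    LastWins = r ≡ 0 ⊎ (r ℕ.≥ 1 × (+ a - + r * + F) * + b > + f * + a)

    frobenius-last : LastWins → IsFrobeniusNumber 0 (a ∷ b ∷ c ∷ [])
                       ((+ a - + 1) * + b - + a * (+ r * + f + + 1))
    frobenius-last cond = subst (IsFrobeniusNumber 0 (a ∷ b ∷ c ∷ [])) (value-formula {s} {r} a a≡)
      (frobenius {s} {r} (s<F , ℕ.≤-reflexive a≡) (λ {x} {y} → last-maximal (natural cond) {x} {y}))
      where
      natural : LastWins → r ≡ 0 ⊎ f ℕ.* a ℕ.≤ suc s ℕ.* b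
      natural (inj₁ r≡0)      = inj₁ r≡0
      natural (inj₂ (_ , gt)) = inj₂ (ℕ.<⇒≤ (ℤ.drop‿+<+ (subst₂ ℤ._<_ (sym (ℤ.pos-* f a)) remainderℤ gt)))

    frobenius-block-end : ¬ LastWins → IsFrobeniusNumber 0 (a ∷ b ∷ c ∷ [])
                            ((+ r * + F - + 1) * + b - + a * ((+ r - + 1) * + f + + 1))
    -- The parameter `r` is split through a copy tied to it by an equation; the value `0` would
    -- satisfy `LastWins`.
    frobenius-block-end ¬cond = go r refl
      where
      go : ∀ q → r ≡ q → IsFrobeniusNumber 0 (a ∷ b ∷ c ∷ [])
             ((+ r * + F - + 1) * + b - + a * ((+ r - + 1) * + f + + 1))
      go zero     r≡ = ⊥-elim (¬cond (inj₁ r≡))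
      go (suc r′) r≡ = subst (IsFrobeniusNumber 0 (a ∷ b ∷ c ∷ [])) formula
        (frobenius {ℕ.pred F} {r′} (block-end-reduced r≡) (λ {x} {y} → block-end-maximal r≡ ≤fa {x} {y}))
        where
        ≤fa : suc s ℕ.* b ℕ.≤ f ℕ.* a
        ≤fa = ℤ.drop‿+≤+ (subst₂ ℤ._≤_ remainderℤ (sym (ℤ.pos-* f a))
          -- With `r ≥ 1` known, only the inequality in `LastWins` can fail.
          (ℤ.≮⇒≥ λ gt → ¬cond (inj₂ (subst (ℕ._≥ 1) (sym r≡) (s≤s z≤n) , gt))))
        formula : + value (ℕ.pred F) r′ - + a ≡ (+ r * + F - + 1) * + b - + a * ((+ r - + 1) * + f + + 1)
        formula = trans (value-formula {ℕ.pred F} {r′} (r ℕ.* F) (block-end-weight r≡))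
          (cong₂ (λ rF r-1 → (rF - + 1) * + b - + a * (r-1 * + f + + 1))
            -- Here `+ suc r′ - + 1` computes to `+ r′`.
            (ℤ.pos-* r F) (cong (λ r → + r - + 1) (sym r≡)))

-- Arithmetic of Lucas and Fibonacci numbers.

L-pos : ∀ n → 0 ℕ.< L n
L-pos zero          = s≤s z≤n
L-pos (suc zero)    = s≤s z≤n
L-pos (suc (suc n)) = ℕ.≤-trans (L-pos (suc n)) (ℕ.m≤m+n _ (L n))

-- The recurrence is a step of Euclid's algorithm.
coprime-L-suc : ∀ n → Coprime (L n) (L (suc n))
coprime-L-suc zero    = Coprimality.sym (Coprimality.1-coprimeTo 2)
coprime-L-suc (suc n) = Coprimality.sym (coprime-+ (coprime-L-suc n))

coprime-L-suc² : ∀ n → Coprime (L n) (L (2 ℕ.+ n))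
coprime-L-suc² n = Coprimality.sym (subst (λ m → Coprime m (L n)) (ℕ.+-comm (L n) (L (suc n)))
  (coprime-+ (Coprimality.sym (coprime-L-suc n))))

F-≤-suc : ∀ n → F n ℕ.≤ F (suc n)
F-≤-suc zero    = z≤n
F-≤-suc (suc n) = ℕ.m≤m+n (F (suc n)) (F n)

2F≤F : ∀ n → 2 ℕ.* F n ℕ.≤ F (2 ℕ.+ n)
2F≤F n = subst (ℕ._≤ F (2 ℕ.+ n)) (double (F n)) (ℕ.+-monoˡ-≤ (F n) (F-≤-suc n))
  where
  double : ∀ m → m ℕ.+ m ≡ 2 ℕ.* m
  double = ℕ-Ring.solve-∀

-- With `k = 2 + j` this is the relation `c + f a = F b`. For fixed `i` both sides satisfy the
-- Fibonacci recurrence in `j`, so two base cases suffice.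
L-shift : ∀ i j → L (2 ℕ.+ j ℕ.+ i) ℕ.+ F j ℕ.* L i ≡ F (2 ℕ.+ j) ℕ.* L (2 ℕ.+ i)
L-shift i zero          = lemma (L (suc i)) (L i)
  where
  lemma : ∀ m n → m ℕ.+ n ℕ.+ 0 ≡ 1 ℕ.* (m ℕ.+ n)
  lemma = ℕ-Ring.solve-∀
L-shift i (suc zero)    = lemma (L (suc i)) (L i)
  where
  lemma : ∀ m n → m ℕ.+ n ℕ.+ m ℕ.+ 1 ℕ.* n ≡ 2 ℕ.* (m ℕ.+ n)
  lemma = ℕ-Ring.solve-∀
L-shift i (suc (suc j)) = begin
  l₁ ℕ.+ l₀ ℕ.+ (F (suc j) ℕ.+ F j) ℕ.* L i
    ≡⟨ interchange l₁ l₀ (F (suc j)) (F j) (L i) ⟩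
  (l₁ ℕ.+ F (suc j) ℕ.* L i) ℕ.+ (l₀ ℕ.+ F j ℕ.* L i)
    ≡⟨ cong₂ ℕ._+_ (L-shift i (suc j)) (L-shift i j) ⟩
  F (3 ℕ.+ j) ℕ.* L (2 ℕ.+ i) ℕ.+ F (2 ℕ.+ j) ℕ.* L (2 ℕ.+ i)
    ≡⟨ ℕ.*-distribʳ-+ (L (2 ℕ.+ i)) (F (3 ℕ.+ j)) (F (2 ℕ.+ j)) ⟨
  F (4 ℕ.+ j) ℕ.* L (2 ℕ.+ i) ∎
  where
  open ≡-Reasoning
  l₁ = L (3 ℕ.+ j ℕ.+ i)
  l₀ = L (2 ℕ.+ j ℕ.+ i)
  interchange : ∀ m n p q l → m ℕ.+ n ℕ.+ (p ℕ.+ q) ℕ.* l ≡ (m ℕ.+ p ℕ.* l) ℕ.+ (n ℕ.+ q ℕ.* l)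
  interchange = ℕ-Ring.solve-∀

theorem1 : ∀ (i k : ℕ) → 3 ℕ.≤ i → (3≤k : 3 ℕ.≤ k) →
    let r    = ℕ._/_ (L i ℕ.∸ 1) (F k) {{F-nonZero 3≤k}}
        as   = L i ∷ L (i ℕ.+ 2) ∷ L (i ℕ.+ k) ∷ []
        Lᵢ   = + L i
        Lᵢ₊₂ = + L (i ℕ.+ 2)
        Fₖ   = + F k
        Fₖ₋₂ = + F (k ℕ.∸ 2)
        case₁ = r ≡ 0 ⊎ (r ℕ.≥ 1 × (Lᵢ - + r * Fₖ) * Lᵢ₊₂ > Fₖ₋₂ * Lᵢ)
    in (case₁ → IsFrobeniusNumber 0 as
          ((Lᵢ - + 1) * Lᵢ₊₂ - Lᵢ * (+ r * Fₖ₋₂ + + 1)))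
     × (¬ case₁ → IsFrobeniusNumber 0 as
          ((+ r * Fₖ - + 1) * Lᵢ₊₂ - Lᵢ * ((+ r - + 1) * Fₖ₋₂ + + 1)))
theorem1 i (suc zero) _ (s≤s ())
-- Writing `k` as `2 + j` lets `F (k ∸ 2)` compute to `F j`, the `f` of the Apéry argument.
theorem1 i k@(suc (suc j)) _ 3≤k =
  frobenius-last {s} {r} s<F decompose , frobenius-block-end {s} {r} s<F decompose
  where
  instance
    L-nonZero : NonZero (L i)
    L-nonZero = ℕ.>-nonZero (L-pos i)
    Fₖ-nonZero : NonZero (F k)
    Fₖ-nonZero = F-nonZero 3≤k
  r = (L i ℕ.∸ 1) ℕ./ F k
  s = (L i ℕ.∸ 1) ℕ.% F k
  s<F : s ℕ.< F k
  s<F = ℕ.m%n<n (L i ℕ.∸ 1) (F k)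
  -- Positivity of `L i` makes the truncated `L i ∸ 1` exact.
  decompose : suc (s ℕ.+ r ℕ.* F k) ≡ L i
  decompose = trans (cong suc (sym (ℕ.m≡m%n+[m/n]*n (L i ℕ.∸ 1) (F k)))) (ℕ.m+[n∸m]≡n (L-pos i))
  open Apéry {L i} {L (i ℕ.+ 2)} {L (i ℕ.+ k)} {F k} {F j}
    (subst (λ n → Coprime (L i) (L n)) (ℕ.+-comm 2 i) (coprime-L-suc² i))
    (subst (λ n → L i ℕ.≤ L n) (ℕ.+-comm 2 i) (ℕ.m≤n+m (L i) (L (suc i))))
    (2F≤F j)
    (subst₂ (λ m n → L n ℕ.+ F j ℕ.* L i ≡ F k ℕ.* L m) (ℕ.+-comm 2 i) (ℕ.+-comm k i) (L-shift i j))
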